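{- Let $G$ be a finite, simple, undirected, connected graph. A vertex $v\in V(G)$ is an $\mathcal{L}$-branch leaf of some DFS ordering of $G$ if and only if $v$ is the end-vertex (last vertex) of some DFS ordering of $G$.
   Context: A vertex ordering of $G$ is a bijection $\sigma:\{1,\dots,n\}\to V(G)$; $u\prec_\sigma w$ means $u$ comes before $w$. Depth First Search (DFS) orderings are produced by the label search: initially all labels are $\emptyset$; for $i=1,\dots,n$ choose any unnumbered vertex $x$ such that there is no unnumbered $y$ with $\mathrm{label}(x)\prec\mathrm{label}(y)$, set $\sigma(i)=x$, and add $i$ to the labels of the unnumbered neighbors of $x$, where $A\prec B$ iff ($A=\emptyset$ and $B\neq\emptyset$) or $\max(A)<\max(B)$. The $\mathcal{L}$-tree of $\sigma$ is the spanning tree containing, for each $v\neq\sigma(1)$, the edge from $v$ to its rightmost neighbor $w$ with $w\prec_\sigma v$. A vertex $v\neq\sigma(1)$ is an $\mathcal{L}$-branch leaf of $\sigma$ if it is a leaf of the $\mathcal{L}$-tree of $\sigma$.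
   Formalization: The graph is assumed to have at least two vertices; for the one-vertex graph the statement fails, since its only vertex is the end-vertex of the unique DFS ordering but equals σ(1) and so is not a branch leaf. -}

module Defs where

open import Data.Bool.Base using (if_then_else_)
open import Data.Fin.Base using (Fin; toℕ; fromℕ<; _≤_; _<_)
open import Data.Fin.Permutation using (Permutation′; _⟨$⟩ʳ_; _⟨$⟩ˡ_)
open import Data.Fin.Properties using (_<?_; toℕ≤n)
open import Data.Fin.Subset using (Subset; _∈_; _∪_; ⊥; ⁅_⁆; Empty; Nonempty)
open import Data.Nat.Base as ℕ using (ℕ; zero; suc)
open import Data.Nat.Properties using (<⇒≤)
open import Data.Product using (_×_; ∃-syntax; ∃!)
open import Data.Sum.Base using (_⊎_)
open import Level using (0ℓ)
open import Relation.Binary.Construct.Closure.ReflexiveTransitive using (Star)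
open import Relation.Binary.Core using (Rel)
open import Relation.Binary.Definitions using (Symmetric; Irreflexive; Decidable)
open import Relation.Binary.PropositionalEquality.Core using (_≡_)
open import Relation.Nullary.Decidable.Core using (does; _×-dec_)
open import Relation.Nullary.Negation.Core using (¬_)

Vertex : ℕ → Set
Vertex = Fin

record Graph (n : ℕ) : Set₁ where
  field
    Adj        : Rel (Vertex n) 0ℓ
    adj?       : Decidable Adj
    adj-sym    : Symmetric Adj
    adj-irrefl : Irreflexive _≡_ Adj

open Graph public

Connected : {n : ℕ} → Graph n → Set
Connected G = ∀ u v → Star (Adj G) u v

-- A bijection from positions to vertices.  Positions are counted from 0,
-- which does not affect any comparison between them.
Ordering : ℕ → Set
Ordering n = Permutation′ n

vertexAt : {n : ℕ} → Ordering n → Fin n → Vertex n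
vertexAt σ i = σ ⟨$⟩ʳ i

position : {n : ℕ} → Ordering n → Vertex n → Fin n
position σ v = σ ⟨$⟩ˡ v

Before : {n : ℕ} → Ordering n → Rel (Vertex n) 0ℓ
Before σ u w = position σ u < position σ w

IsFirst : {n : ℕ} → Ordering n → Vertex n → Set
IsFirst σ v = toℕ (position σ v) ≡ 0

IsLast : {n : ℕ} → Ordering n → Vertex n → Set
IsLast {n} σ v = suc (toℕ (position σ v)) ≡ n

Label : ℕ → Set
Label = Subset

IsMax : {n : ℕ} → Label n → Fin n → Set
IsMax A a = a ∈ A × (∀ {b} → b ∈ A → b ≤ a)

infix 4 _≺_

-- The second alternative holds only if both labels are nonempty, since
-- max ∅ is undefined.
_≺_ : {n : ℕ} → Rel (Label n) 0ℓ
A ≺ B = (Empty A × Nonempty B)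
      ⊎ (∃[ a ] ∃[ b ] IsMax A a × IsMax B b × a < b)

-- The labels after the first k vertices of σ have been numbered.  After
-- step i the unnumbered vertices are those at positions beyond i.
labels : {n : ℕ} → Graph n → Ordering n →
         (k : ℕ) → .(k ℕ.≤ n) → Vertex n → Label n
labels G σ zero    _   y = ⊥
labels G σ (suc k) k<n y =
  if does ((i <? position σ y) ×-dec adj? G (vertexAt σ i) y)
  then old ∪ ⁅ i ⁆
  else old
  where
  i   = fromℕ< k<n
  old = labels G σ k (<⇒≤ k<n) y

labelAtStep : {n : ℕ} → Graph n → Ordering n → Fin n → Vertex n → Label n
labelAtStep G σ i = labels G σ (toℕ i) (toℕ≤n i)

-- When the i-th vertex is chosen, the unnumbered vertices are those at
-- position i or later.
IsDFS : {n : ℕ} → Graph n → Ordering n → Set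
IsDFS G σ = ∀ i → ¬ (∃[ y ] i ≤ position σ y
                          × labelAtStep G σ i (vertexAt σ i) ≺ labelAtStep G σ i y)

-- w is the rightmost neighbour of v among those before v.
IsParent : {n : ℕ} → Graph n → Ordering n → (v w : Vertex n) → Set
IsParent G σ v w =
    (Adj G v w × Before σ w v)
  × (∀ u → Adj G v u → Before σ u v → position σ u ≤ position σ w)

-- The first vertex has no vertex before it, hence no parent, so it needs
-- no explicit exclusion here.
LTreeEdge : {n : ℕ} → Graph n → Ordering n → Rel (Vertex n) 0ℓ
LTreeEdge G σ u w = IsParent G σ u w ⊎ IsParent G σ w u

-- A vertex of degree one.
IsLeaf : {n : ℕ} → Rel (Vertex n) 0ℓ → Vertex n → Set
IsLeaf E v = ∃! _≡_ (E v)

-- In a one-vertex graph the only vertex is first in its ordering, so it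
-- is not a branch leaf even though it is an end-vertex.
IsLBranchLeaf : {n : ℕ} → Graph n → Ordering n → Vertex n → Set
IsLBranchLeaf G σ v = ¬ IsFirst σ v × IsLeaf (LTreeEdge G σ) v

IsDFSBranchLeaf : {n : ℕ} → Graph n → Vertex n → Set
IsDFSBranchLeaf G v = ∃[ σ ] IsDFS G σ × IsLBranchLeaf G σ v

IsDFSEndVertex : {n : ℕ} → Graph n → Vertex n → Set
IsDFSEndVertex G v = ∃[ σ ] IsDFS G σ × IsLast σ v

{-# OPTIONS --safe #-}
-- A search ordering is a DFS ordering iff for all a, b, c in this order with
-- a adjacent to c some neighbour of b lies between a (inclusive) and b.  Every
-- edge then joins an ancestor to a descendant in the 𝓛-tree, and the
-- descendants of a vertex are consecutive.  Visiting the same tree with the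
-- branch towards a leaf v always taken last, that is, sorting the vertices
-- lexicographically by the position of their deepest common ancestor with v
-- and then by their own position, gives a DFS ordering ending in v.
module Submission where

open import Defs
open import Data.Bool.Base using (if_then_else_)
open import Data.Bool.Properties using (T-≡)
open import Data.Fin.Base using (Fin; toℕ; fromℕ<; zero; suc; combine; punchOut)
open import Data.Fin.Permutation using (permutation; inverseˡ; inverseʳ)
open import Data.Fin.Properties as Fin using (_≟_; toℕ-injective; toℕ<n; any?)
open import Data.Fin.Subset using (Subset; _∈_; ⊤; _∪_; ⁅_⁆; ∣_∣)
open import Data.Fin.Subset.Properties
  using (_∈?_; nonempty?; ∈⊤; ∉⊥; ∣⊤∣≡n; p⊂q⇒∣p∣<∣q∣; x∈⁅x⁆; x∈⁅y⁆⇒x≡y; x∈p∪q⁻; p⊆p∪q; q⊆p∪q)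
open import Data.Nat.Base as ℕ using (ℕ; zero; suc; _≤_; _<_; z≤n; s≤s)
open import Data.Nat.Induction using (<-wellFounded)
open import Data.Nat.Properties as ℕ using (≤-refl; ≤-trans; ≤-reflexive; <⇒≤)
open import Data.Product using (_×_; _,_; ∃-syntax; proj₁; proj₂)
open import Data.Sum.Base using (_⊎_; inj₁; inj₂)
open import Data.Vec.Base using (tabulate)
open import Data.Vec.Properties using (lookup∘tabulate; lookup⇒[]=; []=⇒lookup)
open import Function.Base using (_∘_)
open import Function.Bundles using (_⇔_; mk⇔; Equivalence)
open import Function.Definitions using (Injective)
open import Induction.WellFounded using (Acc; acc)
open import Relation.Binary.Construct.Closure.ReflexiveTransitive using (Star; ε; _◅_; _◅◅_)
open import Relation.Binary.Definitions using (tri<; tri≈; tri>)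
open import Relation.Binary.PropositionalEquality
  using (_≡_; _≢_; refl; sym; trans; cong; subst; subst₂)
open import Relation.Nullary using (Dec; yes; no; ¬_; contradiction)
open import Relation.Nullary.Decidable using (does; dec-true; _×-dec_; map′)
open import Relation.Unary using (Pred)
import Relation.Unary as U

-- Greatest elements and injections on finite sets.

Greatest : ∀ {n} → Pred (Fin n) _ → Fin n → Set
Greatest P a = P a × (∀ {b} → P b → toℕ b ≤ toℕ a)

greatest : ∀ {n} {P : Pred (Fin n) _} → U.Decidable P → ∀ {i} → P i → ∃[ a ] Greatest P a
greatest {suc n} {P} P? {i} Pi with any? (P? ∘ suc)
... | yes (_ , Pj) with a , Pa , a-max ← greatest (P? ∘ suc) Pj = suc a , Pa , suc-max
  where
  suc-max : ∀ {b} → P b → toℕ b ≤ suc (toℕ a)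
  suc-max {zero}  _  = z≤n
  suc-max {suc b} Pb = s≤s (a-max Pb)
greatest {suc n} {P} P? {suc i} Pi | no none = contradiction (i , Pi) none
greatest {suc n} {P} P? {zero}  Pi | no none = zero , Pi , zero-max
  where
  zero-max : ∀ {b} → P b → toℕ b ≤ 0
  zero-max {zero}  _  = z≤n
  zero-max {suc b} Pb = contradiction (b , Pb) none

-- If `y` were missed, punching it out would inject `Fin (suc n)` into `Fin n`.
injective⇒surjective : ∀ {n} {f : Fin n → Fin n} → Injective _≡_ _≡_ f → ∀ y → ∃[ x ] f x ≡ y
injective⇒surjective {suc n} {f} f-inj y with any? (λ x → f x ≟ y)
... | yes p = p
... | no ∄x = contradiction (Fin.injective⇒≤ g-inj) ℕ.1+n≰n
  where
  y≢f : ∀ x → y ≢ f x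
  y≢f x y≡fx = ∄x (x , sym y≡fx)
  g-inj : Injective _≡_ _≡_ (λ x → punchOut (y≢f x))
  g-inj {x} {x′} eq = f-inj (Fin.punchOut-injective (y≢f x) (y≢f x′) eq)

-- Sorting by an injective key.

module _ {n m} (key : Fin n → Fin m) where

  below : Fin n → Subset n
  below x = tabulate (λ y → does (key y Fin.<? key x))

  ∈below⁺ : ∀ {x y} → toℕ (key y) < toℕ (key x) → y ∈ below x
  ∈below⁺ {x} {y} y<x =
    lookup⇒[]= y _ (trans (lookup∘tabulate _ y) (dec-true (key y Fin.<? key x) y<x))

  ∈below⁻ : ∀ {x y} → y ∈ below x → toℕ (key y) < toℕ (key x)
  ∈below⁻ {x} {y} y∈ = ℕ.<ᵇ⇒< _ _
    (Equivalence.from T-≡ (trans (sym (lookup∘tabulate _ y)) ([]=⇒lookup y∈)))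

  -- Counting the smaller keys gives the place of `x` in the sorted order. The count stays below `n`
  -- because `x` is not below itself.
  rank : Fin n → Fin n
  rank x = fromℕ< (subst (∣ below x ∣ <_) (∣⊤∣≡n n)
    (p⊂q⇒∣p∣<∣q∣ ((λ _ → ∈⊤) , x , ∈⊤ , ℕ.<-irrefl refl ∘ ∈below⁻)))

  rank-mono : ∀ {x y} → toℕ (key x) < toℕ (key y) → toℕ (rank x) < toℕ (rank y)
  rank-mono {x} {y} x<y = subst₂ _<_ (sym (Fin.toℕ-fromℕ< _)) (sym (Fin.toℕ-fromℕ< _))
    (p⊂q⇒∣p∣<∣q∣
      ((λ z∈ → ∈below⁺ (ℕ.<-trans (∈below⁻ z∈) x<y)) , x , ∈below⁺ x<y , ℕ.<-irrefl refl ∘ ∈below⁻))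

  module _ (key-inj : Injective _≡_ _≡_ key) where

    rank-reflects : ∀ {x y} → toℕ (rank x) < toℕ (rank y) → toℕ (key x) < toℕ (key y)
    rank-reflects {x} {y} x<y with ℕ.<-cmp (toℕ (key x)) (toℕ (key y))
    ... | tri< lt _ _ = lt
    ... | tri≈ _ eq _ with refl ← key-inj (toℕ-injective eq) = contradiction x<y (ℕ.<-irrefl refl)
    ... | tri> _ _ gt = contradiction (rank-mono gt) (ℕ.<-asym x<y)

    rank-injective : Injective _≡_ _≡_ rank
    rank-injective {x} {y} eq with ℕ.<-cmp (toℕ (key x)) (toℕ (key y))
    ... | tri< lt _ _ = contradiction (rank-mono lt) (ℕ.<-irrefl (cong toℕ eq))
    ... | tri≈ _ e _  = key-inj (toℕ-injective e)
    ... | tri> _ _ gt = contradiction (rank-mono gt) (ℕ.<-irrefl (cong toℕ (sym eq)))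

    sortBy : ∃[ τ ] (∀ {x y} → Before τ x y ⇔ toℕ (key x) < toℕ (key y))
    sortBy = permutation (proj₁ ∘ rank-surj) rank
               (λ x → rank-injective (proj₂ (rank-surj (rank x)))) (proj₂ ∘ rank-surj)
           , mk⇔ rank-reflects rank-mono
      where rank-surj = injective⇒surjective rank-injective

-- Positions and the four-point condition.

module _ {n} (σ : Ordering n) where

  pos : Vertex n → ℕ
  pos v = toℕ (position σ v)

  pos-injective : Injective _≡_ _≡_ pos
  pos-injective {x} {y} eq =
    trans (sym (inverseʳ σ)) (trans (cong (vertexAt σ) (toℕ-injective eq)) (inverseʳ σ))

  FourPoint : Graph n → Set
  FourPoint G = ∀ {a b c} → pos a < pos b → pos b < pos c → Adj G a c →
                ∃[ d ] pos a ≤ pos d × pos d < pos b × Adj G d b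

  last : (v : Vertex n) → (∀ x → x ≢ v → pos x < pos v) → IsLast σ v
  last v v-max = ℕ.≤-antisym (toℕ<n (position σ v)) (ℕ.≮⇒≥ λ 1+v<n →
    let x   = vertexAt σ (fromℕ< 1+v<n)
        x≡  = trans (cong toℕ (inverseˡ σ)) (Fin.toℕ-fromℕ< 1+v<n)
        v<x = ≤-reflexive (sym x≡)
    in ℕ.<-asym v<x (v-max x λ x≡v → ℕ.<-irrefl (cong pos (sym x≡v)) v<x))

-- Labels and their link to the four-point condition.

∈-extend⁻ : ∀ {n} {P : Set} (P? : Dec P) {L : Subset n} {i j} →
            j ∈ (if does P? then L ∪ ⁅ i ⁆ else L) → j ∈ L ⊎ (P × j ≡ i)
∈-extend⁻ (no _)  j∈ = inj₁ j∈
∈-extend⁻ (yes p) {L} j∈ with x∈p∪q⁻ L _ j∈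
... | inj₁ j∈L   = inj₁ j∈L
... | inj₂ j∈⁅i⁆ = inj₂ (p , x∈⁅y⁆⇒x≡y _ j∈⁅i⁆)

∈-extend⁺ : ∀ {n} {P : Set} (P? : Dec P) {L : Subset n} {i j} →
            j ∈ L ⊎ (P × j ≡ i) → j ∈ (if does P? then L ∪ ⁅ i ⁆ else L)
∈-extend⁺ (no _)  (inj₁ j∈L)        = j∈L
∈-extend⁺ (no ¬p) (inj₂ (p , _))    = contradiction p ¬p
∈-extend⁺ (yes _) (inj₁ j∈L)        = p⊆p∪q _ j∈L
∈-extend⁺ (yes _) {L} (inj₂ (_ , refl)) = q⊆p∪q L _ (x∈⁅x⁆ _)

module _ {n} (G : Graph n) (σ : Ordering n) where

  -- Definitionally the test inside `labels`, so that `∈-extend⁻` and `∈-extend⁺` apply to its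
  -- recursive step.
  numbers? : ∀ i y → Dec (toℕ i < pos σ y × Adj G (vertexAt σ i) y)
  numbers? i y = (i Fin.<? position σ y) ×-dec adj? G (vertexAt σ i) y

  ∈-labels⁻ : ∀ k .(k≤n : k ≤ n) {y i} → i ∈ labels G σ k k≤n y →
              toℕ i < k × toℕ i < pos σ y × Adj G (vertexAt σ i) y
  ∈-labels⁻ zero    _   i∈ = contradiction i∈ ∉⊥
  ∈-labels⁻ (suc k) k<n {y} i∈ with ∈-extend⁻ (numbers? (fromℕ< k<n) y) i∈
  ... | inj₁ i∈old with i<k , i-numbers ← ∈-labels⁻ k _ i∈old = ℕ.m<n⇒m<1+n i<k , i-numbers
  ... | inj₂ (k-numbers , refl) = s≤s (≤-reflexive (Fin.toℕ-fromℕ< k<n)) , k-numbers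

  ∈-labels⁺ : ∀ k .(k≤n : k ≤ n) {y i} → toℕ i < k → toℕ i < pos σ y →
              Adj G (vertexAt σ i) y → i ∈ labels G σ k k≤n y
  ∈-labels⁺ (suc k) k<n {y} i<1+k i<y i~y with ℕ.m<1+n⇒m<n∨m≡n i<1+k
  ... | inj₁ i<k = ∈-extend⁺ (numbers? (fromℕ< k<n) y) (inj₁ (∈-labels⁺ k _ i<k i<y i~y))
  ... | inj₂ i≡k with refl ← toℕ-injective (trans i≡k (sym (Fin.toℕ-fromℕ< k<n))) =
    ∈-extend⁺ (numbers? (fromℕ< k<n) y) (inj₂ ((i<y , i~y) , refl))

  ∈-label⁻ : ∀ {i y a} → a ∈ labelAtStep G σ i y →
             toℕ a < toℕ i × Adj G (vertexAt σ a) y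
  ∈-label⁻ {i} a∈ with p , _ , q ← ∈-labels⁻ (toℕ i) _ a∈ = p , q

  ∈-label⁺ : ∀ {i x y} → pos σ x < toℕ i → toℕ i ≤ pos σ y → Adj G x y →
             position σ x ∈ labelAtStep G σ i y
  ∈-label⁺ {i} x<i i≤y x~y = ∈-labels⁺ (toℕ i) _ x<i (ℕ.<-≤-trans x<i i≤y)
    (subst (λ z → Adj G z _) (sym (inverseʳ σ)) x~y)

  -- When `b` is chosen, `c` is unnumbered and its label contains the position of `a`. Hence the
  -- label of `b` is nonempty, and its maximum, at least that of the label of `c`, is the position
  -- of the wanted neighbour.
  DFS⇒FourPoint : IsDFS G σ → FourPoint σ G
  DFS⇒FourPoint dfs {a} {b} {c} a<b b<c a~c = result
    where
    i = position σ b
    Lb = labelAtStep G σ i (vertexAt σ i)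
    Lc = labelAtStep G σ i c
    a∈Lc : position σ a ∈ Lc
    a∈Lc = ∈-label⁺ a<b (<⇒≤ b<c) a~c
    result : ∃[ d ] pos σ a ≤ pos σ d × pos σ d < pos σ b × Adj G d b
    result with nonempty? Lb
    ... | no  Lb≡∅ = contradiction (c , <⇒≤ b<c , inj₁ (Lb≡∅ , _ , a∈Lc)) (dfs i)
    ... | yes (_ , ∈Lb) with greatest (_∈? Lb) ∈Lb | greatest (_∈? Lc) a∈Lc
    ...   | β , β∈ , β-max | γ , γ∈ , γ-max
      with β<i , β~b ← ∈-label⁻ {i} β∈ =
        vertexAt σ β
      , ≤-trans (γ-max a∈Lc) (≤-trans γ≤β (≤-reflexive (sym β≡)))
      , subst (_< pos σ b) (sym β≡) β<i
      , subst (Adj G _) (inverseʳ σ) β~b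
      where
      γ≤β : toℕ γ ≤ toℕ β
      γ≤β = ℕ.≮⇒≥ λ β<γ →
        dfs i (c , <⇒≤ b<c , inj₂ (β , γ , (β∈ , β-max) , (γ∈ , γ-max) , β<γ))
      β≡ : pos σ (vertexAt σ β) ≡ toℕ β
      β≡ = cong toℕ (inverseˡ σ)

  -- Every entry in the label of a later rival `y` is matched by an entry at least as large in the
  -- label of the chosen vertex, which refutes both alternatives of `≺`.
  FourPoint⇒DFS : FourPoint σ G → IsDFS G σ
  FourPoint⇒DFS fp i (y , i≤y , Lx≺Ly) with ℕ.m≤n⇒m<n∨m≡n i≤y
  -- Here `y` is the chosen vertex itself, and `≺` is irreflexive.
  ... | inj₂ i≡y with refl ← toℕ-injective i≡y =
    ≺-irrefl (subst (λ z → labelAtStep G σ i z ≺ labelAtStep G σ i y) (inverseʳ σ) Lx≺Ly)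
    where
    ≺-irrefl : ∀ {L : Label n} → ¬ (L ≺ L)
    ≺-irrefl (inj₁ (empty , nonempty)) = empty nonempty
    ≺-irrefl (inj₂ (a , b , (_ , a-max) , (b∈ , _) , a<b)) = ℕ.<⇒≱ a<b (a-max b∈)
  ... | inj₁ i<y = case Lx≺Ly
    where
    i≡ : pos σ (vertexAt σ i) ≡ toℕ i
    i≡ = cong toℕ (inverseˡ σ)
    rival : ∀ {c} → c ∈ labelAtStep G σ i y →
            ∃[ d ] toℕ c ≤ toℕ d × d ∈ labelAtStep G σ i (vertexAt σ i)
    rival {c} c∈ with c<i , c~y ← ∈-label⁻ {i} c∈
      with d , c≤d , d<i , d~i ← fp {vertexAt σ c} {vertexAt σ i} {y}
             (subst₂ _<_ (sym (cong toℕ (inverseˡ σ))) (sym i≡) c<i)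
             (subst (_< pos σ y) (sym i≡) i<y) c~y
      = position σ d
      , subst (_≤ pos σ d) (cong toℕ (inverseˡ σ)) c≤d
      , ∈-label⁺ {i} (subst (pos σ d <_) i≡ d<i) (≤-reflexive (sym i≡)) d~i
    case : ¬ (labelAtStep G σ i (vertexAt σ i) ≺ labelAtStep G σ i y)
    case (inj₁ (empty , _ , c∈)) with d , _ , d∈ ← rival c∈ = empty (d , d∈)
    case (inj₂ (a , b , (_ , a-max) , (b∈ , _) , a<b)) with d , b≤d , d∈ ← rival b∈ =
      ℕ.<⇒≱ a<b (≤-trans b≤d (a-max d∈))

  -- Parents and crossing edges.

  IsParent-unique : ∀ {v w w′} → IsParent G σ v w → IsParent G σ v w′ → w ≡ w′
  IsParent-unique ((v~w , w<v) , w-max) ((v~w′ , w′<v) , w′-max) =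
    pos-injective σ (ℕ.≤-antisym (w′-max _ v~w w<v) (w-max _ v~w′ w′<v))

  parent : ∀ {u v} → Adj G v u → pos σ u < pos σ v → ∃[ w ] IsParent G σ v w
  parent {u} {v} v~u u<v
    with greatest (λ i → adj? G v (vertexAt σ i) ×-dec i Fin.<? position σ v)
           {position σ u} (subst (Adj G v) (sym (inverseʳ σ)) v~u , u<v)
  ... | w , (v~w , w<v) , w-max = vertexAt σ w
      , (v~w , subst (_< pos σ v) (sym w≡) w<v)
      , λ x v~x x<v → ≤-trans (w-max (subst (Adj G v) (sym (inverseʳ σ)) v~x , x<v))
                           (≤-reflexive (sym w≡))
    where
    w≡ : pos σ (vertexAt σ w) ≡ toℕ w
    w≡ = cong toℕ (inverseˡ σ)

  -- Turns connectivity into an edge to which the four-point condition applies: the first step of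
  -- the path that reaches position `m` or beyond.
  crossing : ∀ m {u v} → pos σ u < m → m ≤ pos σ v → Star (Adj G) u v →
             ∃[ a ] ∃[ c ] pos σ a < m × m ≤ pos σ c × Adj G a c
  crossing m u<m m≤v ε = contradiction m≤v (ℕ.<⇒≱ u<m)
  crossing m {u} u<m m≤v (_◅_ {j = x} u~x xs) with m ℕ.≤? pos σ x
  ... | yes m≤x = u , x , u<m , m≤x , u~x
  ... | no  m≰x = crossing m (ℕ.≰⇒> m≰x) m≤v xs

-- Sorting preserves the order of the keys, so the four-point condition passes from keys to
-- positions.
endVertex-sortBy :
  ∀ {n m} (G : Graph n) (key : Vertex n → Fin m) → Injective _≡_ _≡_ key →
  (∀ {a b c} → toℕ (key a) < toℕ (key b) → toℕ (key b) < toℕ (key c) → Adj G a c →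
   ∃[ d ] toℕ (key a) ≤ toℕ (key d) × toℕ (key d) < toℕ (key b) × Adj G d b) →
  ∀ v → (∀ x → x ≢ v → toℕ (key x) < toℕ (key v)) → IsDFSEndVertex G v
endVertex-sortBy G key key-inj key-fourPoint v key-max =
  τ , FourPoint⇒DFS G τ τ-fourPoint , last τ v (λ x x≢v → sorted (key-max x x≢v))
  where
  τ : Ordering _
  τ = proj₁ (sortBy key key-inj)
  sorted : ∀ {x y} → toℕ (key x) < toℕ (key y) → pos τ x < pos τ y
  sorted = Equivalence.from (proj₂ (sortBy key key-inj))
  key< : ∀ {x y} → pos τ x < pos τ y → toℕ (key x) < toℕ (key y)
  key< = Equivalence.to (proj₂ (sortBy key key-inj))
  τ-fourPoint : FourPoint τ G
  τ-fourPoint {a} {b} {c} a<b b<c a~c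
    with d , a≤d , d<b , d~b ← key-fourPoint (key< {a} a<b) (key< {b} b<c) a~c =
    -- `key<` and `sorted` transport only strict inequalities, so the weak one is obtained by
    -- refuting its converse.
    d , ℕ.≮⇒≥ (λ d<a → ℕ.<⇒≱ (key< {d} d<a) a≤d) , sorted d<b , d~b

-- The search tree and its ancestor relation.

module SearchTree {n} (G : Graph (suc n)) (connected : Connected G)
                  (σ : Ordering (suc n)) (fourPoint : FourPoint σ G) where

  root : Vertex (suc n)
  root = vertexAt σ zero

  pos-root : pos σ root ≡ 0
  pos-root = cong toℕ (inverseˡ σ)

  -- Admits `b ≡ c`, where `a` itself serves as the neighbour.
  earlierNeighbour : ∀ {a b c} → pos σ a < pos σ b → pos σ b ≤ pos σ c → Adj G a c →
                     ∃[ d ] pos σ a ≤ pos σ d × pos σ d < pos σ b × Adj G d b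
  earlierNeighbour {a} a<b b≤c a~c with ℕ.m≤n⇒m<n∨m≡n b≤c
  ... | inj₁ b<c = fourPoint a<b b<c a~c
  ... | inj₂ b≡c with refl ← pos-injective σ b≡c = a , ≤-refl , a<b , a~c

  hasParent : ∀ {v} → ¬ IsFirst σ v → ∃[ w ] IsParent G σ v w
  hasParent {v} v≢first
    with a , c , a<v , v≤c , a~c ←
      crossing G σ (pos σ v) (subst (_< pos σ v) (sym pos-root) (ℕ.n≢0⇒n>0 v≢first)) ≤-refl
        (connected root v)
    with d , _ , d<v , d~v ← earlierNeighbour a<v v≤c a~c
    = parent G σ (adj-sym G d~v) d<v

  Ancestor : Vertex (suc n) → Vertex (suc n) → Set
  Ancestor a x = Star (IsParent G σ) x a

  rooted : ∀ x → Ancestor root x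
  rooted x = go x (<-wellFounded (pos σ x))
    where
    go : ∀ x → Acc _<_ (pos σ x) → Ancestor root x
    go x (acc rec) with pos σ x ℕ.≟ 0
    ... | yes x≡0 with refl ← pos-injective σ (trans x≡0 (sym pos-root)) = ε
    ... | no  x≢0 with w , p@((_ , w<x) , _) ← hasParent x≢0 = p ◅ go w (rec w<x)

  ancestor-≤ : ∀ {a x} → Ancestor a x → pos σ a ≤ pos σ x
  ancestor-≤ ε = ≤-refl
  ancestor-≤ (((_ , w<x) , _) ◅ ps) = ≤-trans (ancestor-≤ ps) (<⇒≤ w<x)

  -- Parents are unique, so every chain up from `x` is a segment of its path to the root, and
  -- walking that path decides the question.
  ancestor? : ∀ a x → Dec (Ancestor a x)
  ancestor? a x = go (rooted x)
    where
    go : ∀ {x} → Ancestor root x → Dec (Ancestor a x)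
    go {x} ps with a ≟ x
    ... | yes refl = yes ε
    go ε | no a≢x = no λ qs → a≢x (pos-injective σ
      (ℕ.≤-antisym (ancestor-≤ qs) (≤-trans (≤-reflexive pos-root) z≤n)))
    go (p ◅ ps) | no a≢x = map′ (p ◅_) tail (go ps)
      where
      tail : Ancestor a _ → Ancestor a _
      tail ε = contradiction refl a≢x
      tail (q ◅ qs) with refl ← IsParent-unique G σ p q = qs

  -- Climb from `b` towards the root. While the current vertex lies after `a`, it has an earlier
  -- neighbour at or after `a`, so its parent, being rightmost, does not jump over `a`. The climb
  -- therefore hits `a`.
  edge-interval : ∀ {a b c} → Adj G a c → pos σ a ≤ pos σ b → pos σ b ≤ pos σ c →
                  Ancestor a b
  edge-interval {a} {b} {c} a~c = go (rooted b)
    where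
    go : ∀ {b} → Ancestor root b → pos σ a ≤ pos σ b → pos σ b ≤ pos σ c → Ancestor a b
    go ps a≤b b≤c with ℕ.m≤n⇒m<n∨m≡n a≤b
    ... | inj₂ a≡b with refl ← pos-injective σ a≡b = ε
    go ε a≤b b≤c | inj₁ a<b = contradiction (subst (pos σ a <_) pos-root a<b) λ ()
    go (p@((_ , w<b) , w-max) ◅ ps) a≤b b≤c | inj₁ a<b
      with d , a≤d , d<b , d~b ← earlierNeighbour a<b b≤c a~c =
      p ◅ go ps (≤-trans a≤d (w-max d (adj-sym G d~b) d<b)) (≤-trans (<⇒≤ w<b) b≤c)

  -- Unless the chain from `c` up to `a` is trivial, `b` lies in the span of one of its edges, and
  -- `edge-interval` puts `b` below the upper end of that edge.
  interval : ∀ {a b c} → Ancestor a c → pos σ a ≤ pos σ b → pos σ b ≤ pos σ c → Ancestor a b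
  interval ε a≤b b≤c with refl ← pos-injective σ (ℕ.≤-antisym a≤b b≤c) = ε
  interval {a} {b} (_◅_ {j = w} ((c~w , w<c) , _) ps) a≤b b≤c with ℕ.≤-total (pos σ b) (pos σ w)
  ... | inj₁ b≤w = interval ps a≤b b≤w
  ... | inj₂ w≤b = edge-interval (adj-sym G c~w) w≤b b≤c ◅◅ ps

  -- Reordering with the branch towards `v` taken last.

  module LeafLast (v : Vertex (suc n)) where

    -- Depth is measured by position: the ancestors of `v` form a chain along which positions grow
    -- with depth, so the latest common ancestor is the deepest.
    IsMeet : Vertex (suc n) → Vertex (suc n) → Set
    IsMeet x c = Ancestor c x × Ancestor c v ×
                 (∀ {a} → Ancestor a x → Ancestor a v → pos σ a ≤ pos σ c)

    -- The witness is the first ancestor of `v` found while climbing from `x`.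
    meet∃ : ∀ x → ∃[ c ] IsMeet x c
    meet∃ x = go (rooted x)
      where
      go : ∀ {x} → Ancestor root x → ∃[ c ] IsMeet x c
      go ε = root , ε , rooted v , λ a-root _ → ancestor-≤ a-root
      go {x} (p ◅ ps) with ancestor? x v | go ps
      ... | yes x-v | _ = x , ε , x-v , λ a-x _ → ancestor-≤ a-x
      ... | no ¬x-v | c , c-w , c-v , c-max = c , p ◅ c-w , c-v , λ where
        ε        a-v → contradiction a-v ¬x-v
        (q ◅ qs) a-v → c-max (subst (Ancestor _) (IsParent-unique G σ q p) qs) a-v

    meet : Vertex (suc n) → Vertex (suc n)
    meet x = proj₁ (meet∃ x)

    meet-x : ∀ x → Ancestor (meet x) x
    meet-x x = proj₁ (proj₂ (meet∃ x))

    meet-v : ∀ x → Ancestor (meet x) v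
    meet-v x = proj₁ (proj₂ (proj₂ (meet∃ x)))

    meet-greatest : ∀ x {a} → Ancestor a x → Ancestor a v → pos σ a ≤ pos σ (meet x)
    meet-greatest x = proj₂ (proj₂ (proj₂ (meet∃ x)))

    -- `combine` turns the lexicographic order on pairs into the order on numbers. The second
    -- component makes the key injective.
    key : Vertex (suc n) → Fin (suc n ℕ.* suc n)
    key x = combine (position σ (meet x)) (position σ x)

    key< : ∀ {x y} → pos σ (meet x) ≤ pos σ (meet y) → pos σ x < pos σ y →
           toℕ (key x) < toℕ (key y)
    key< {x} {y} mx≤my x<y = subst₂ _<_
      (sym (Fin.toℕ-combine _ (position σ x))) (sym (Fin.toℕ-combine _ (position σ y)))
      (ℕ.+-mono-≤-< (ℕ.*-monoʳ-≤ (suc n) mx≤my) x<y)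

    key<⇒meet≤ : ∀ {x y} → toℕ (key x) < toℕ (key y) → pos σ (meet x) ≤ pos σ (meet y)
    key<⇒meet≤ {x} {y} kx<ky = ℕ.≮⇒≥ λ my<mx →
      ℕ.<-asym kx<ky (Fin.combine-monoˡ-< (position σ y) (position σ x) my<mx)

    key<⇒pos< : ∀ {x y} → toℕ (key x) < toℕ (key y) → pos σ (meet y) ≤ pos σ (meet x) →
                pos σ x < pos σ y
    key<⇒pos< {x} {y} kx<ky my≤mx with ℕ.<-cmp (pos σ x) (pos σ y)
    ... | tri< x<y _ _ = x<y
    ... | tri≈ _ x≡y _ with refl ← pos-injective σ x≡y = contradiction kx<ky (ℕ.<-irrefl refl)
    ... | tri> _ _ y<x = contradiction (key< my≤mx y<x) (ℕ.<-asym kx<ky)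

    key-injective : Injective _≡_ _≡_ key
    key-injective {x} {y} eq = pos-injective σ (cong toℕ (Fin.combine-injectiveʳ
      (position σ (meet x)) (position σ x) (position σ (meet y)) (position σ y) eq))

    -- A common ancestor of `w` and `v` is also one of `x` and `v`, so the meet of `x` is at least
    -- as deep as that of `w`.
    key-parent : ∀ {x w} → IsParent G σ x w → toℕ (key w) < toℕ (key x)
    key-parent {x} {w} p@((_ , w<x) , _) =
      key< (meet-greatest x (p ◅ meet-x w) (meet-v w)) w<x

    key-ancestor : ∀ {a x} → Ancestor a x → toℕ (key a) ≤ toℕ (key x)
    key-ancestor ε        = ≤-refl
    key-ancestor (p ◅ ps) = ≤-trans (key-ancestor ps) (<⇒≤ (key-parent p))

    key-interval : ∀ {a b c} → Ancestor a c → toℕ (key a) < toℕ (key b) →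
                   toℕ (key b) < toℕ (key c) → Ancestor a b
    key-interval {a} {b} {c} a-c a<b b<c with ancestor? a v
    -- In position, `meet b` lies between `a` and `v`, so `interval` makes `a` an ancestor of it.
    ... | yes a-v = meet-x b ◅◅ interval a-v
            (≤-trans (meet-greatest a ε a-v) (key<⇒meet≤ a<b)) (ancestor-≤ (meet-v b))
    -- The meets of `a`, `b` and `c` coincide here, so keys compare as positions do and `interval`
    -- applies directly.
    ... | no ¬a-v = interval a-c
            (<⇒≤ (key<⇒pos< a<b (≤-trans (key<⇒meet≤ b<c) c≤a)))
            (<⇒≤ (key<⇒pos< b<c (≤-trans c≤a (key<⇒meet≤ a<b))))
      where
      -- If the meet of `c` were at or after `a`, it would belong to the branch of `a`, making `a`
      -- an ancestor of `v`. Otherwise `interval` makes it an ancestor of `a` as well.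
      c≤a : pos σ (meet c) ≤ pos σ (meet a)
      c≤a with ℕ.≤-total (pos σ a) (pos σ (meet c))
      ... | inj₁ a≤mc = contradiction (meet-v c ◅◅ interval a-c a≤mc (ancestor-≤ (meet-x c))) ¬a-v
      ... | inj₂ mc≤a = meet-greatest a (interval (meet-x c) mc≤a (ancestor-≤ a-c)) (meet-v c)

    -- The neighbour is the parent of `b`: the edge makes `a` an ancestor of `c`, hence of `b` by
    -- `key-interval`, and keys increase down the tree.
    key-fourPoint : ∀ {a b c} → toℕ (key a) < toℕ (key b) → toℕ (key b) < toℕ (key c) →
                    Adj G a c →
                    ∃[ d ] toℕ (key a) ≤ toℕ (key d) × toℕ (key d) < toℕ (key b) × Adj G d b
    key-fourPoint {a} {b} {c} a<b b<c a~c with ℕ.≤-total (pos σ a) (pos σ c)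
    ... | inj₂ c≤a = contradiction (key-ancestor (edge-interval (adj-sym G a~c) c≤a ≤-refl))
                       (ℕ.<⇒≱ (ℕ.<-trans a<b b<c))
    ... | inj₁ a≤c with key-interval (edge-interval a~c a≤c ≤-refl) a<b b<c
    ...   | ε = contradiction a<b (ℕ.<-irrefl refl)
    ...   | p@((b~w , _) , _) ◅ ps = _ , key-ancestor ps , key-parent p , adj-sym G b~w

    -- The vertex `v` is its own meet, so a larger key would force the meet of `x` to be `v`. Then
    -- `x` would descend from `v`, which has no child.
    key-max : (∀ {x} → ¬ IsParent G σ x v) → ∀ x → x ≢ v → toℕ (key x) < toℕ (key v)
    key-max childless x x≢v with ℕ.<-cmp (toℕ (key x)) (toℕ (key v))
    ... | tri< lt _ _ = lt
    ... | tri≈ _ eq _ = contradiction (key-injective (toℕ-injective eq)) x≢v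
    ... | tri> _ _ v<x = contradiction
      (subst (λ z → Ancestor z x)
        (pos-injective σ (ℕ.≤-antisym (ancestor-≤ (meet-v x)) v≤mx)) (meet-x x))
      v-notAncestor
      where
      v≤mx : pos σ v ≤ pos σ (meet x)
      v≤mx = ≤-trans (meet-greatest v ε ε) (key<⇒meet≤ v<x)
      v-notAncestor : ¬ Ancestor v x
      v-notAncestor ps = go ps x≢v
        where
        go : ∀ {x} → Ancestor v x → x ≢ v → _
        go ε x≢v = x≢v refl
        go (_◅_ {j = w} p ps) x≢v with w ≟ v
        ... | yes refl = childless p
        ... | no  w≢v  = go ps w≢v

    endVertex : (∀ {x} → ¬ IsParent G σ x v) → IsDFSEndVertex G v
    endVertex childless = endVertex-sortBy G key key-injective key-fourPoint v (key-max childless)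

-- Branch leaves and end-vertices.

branchLeaf⇒childless : ∀ {n} (G : Graph n) (σ : Ordering n) {v} → ∃[ w ] IsParent G σ v w →
                       IsLeaf (LTreeEdge G σ) v → ∀ {x} → ¬ IsParent G σ x v
branchLeaf⇒childless G σ (w , p@((_ , w<v) , _)) (_ , _ , unique) q@((_ , v<x) , _)
  -- Uniqueness of the tree neighbour identifies the parent `w` with the child `x`, which would then
  -- lie both before and after `v`.
  with refl ← trans (sym (unique (inj₁ p))) (unique (inj₂ q)) = ℕ.<-asym w<v v<x

theorem4 : (n : ℕ) → 2 ≤ n → (G : Graph n) → Connected G →
    (v : Vertex n) → IsDFSBranchLeaf G v ⇔ IsDFSEndVertex G v
theorem4 (suc n) 2≤n G connected v = mk⇔ ⇒ ⇐
  where
  ⇒ : IsDFSBranchLeaf G v → IsDFSEndVertex G v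
  ⇒ (σ , dfs , v≢first , leaf) =
    LeafLast.endVertex v (branchLeaf⇒childless G σ (hasParent v≢first) leaf)
    where open SearchTree G connected σ (DFS⇒FourPoint G σ dfs)
  ⇐ : IsDFSEndVertex G v → IsDFSBranchLeaf G v
  -- The same ordering serves: nothing follows `v`, so `v` has no child and its parent is its only
  -- tree neighbour.
  ⇐ (σ , dfs , v-last) = σ , dfs , v≢first , proj₁ v-parent , inj₁ (proj₂ v-parent) , unique
    where
    open SearchTree G connected σ (DFS⇒FourPoint G σ dfs)
    v≢first : ¬ IsFirst σ v
    -- A vertex both first and last would force `suc n` to be 1.
    v≢first v-first = ℕ.<-irrefl (trans (cong suc (sym v-first)) v-last) 2≤n
    v-parent : ∃[ w ] IsParent G σ v w
    v-parent = hasParent v≢first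
    unique : ∀ {x} → LTreeEdge G σ v x → proj₁ v-parent ≡ x
    unique     (inj₁ q)               = IsParent-unique G σ (proj₂ v-parent) q
    unique {x} (inj₂ ((_ , v<x) , _)) =
      contradiction (toℕ<n (position σ x)) (ℕ.≤⇒≯ (subst (_≤ pos σ x) v-last v<x))
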